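{- For every integer $n\ge 1$, $$a_n\ge\max\{\tau(n),\tau(2n-1),\tau_o(n+1)\},$$ and more precisely $$a_n\ge \tau(n)+\tau(2n-1)+\tau_o(n+1)-3-\delta_{n\equiv 0 \bmod 2}-\delta_{n\equiv -1\bmod 3}.$$
   Context: For an integer $n\ge1$, $a_n$ denotes the number of integers $x$ with $0\le x\le n-1$ for which there exists a positive integer $h$ with $h\mid x$ and $(2x+1)\mid(2n-2h+1)$ (every positive integer divides $0$). $\tau(m)$ is the number of positive divisors of $m$, $\tau_o(m)$ is the number of odd positive divisors of $m$, and $\delta_P$ equals $1$ if the condition $P$ holds and $0$ otherwise. -}

module Defs where

open import Data.Bool.Base using (if_then_else_)
open import Data.Integer as ℤ using (ℤ; +_; 1ℤ)
import Data.Integer.Divisibility as ℤ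
open import Data.List.Base using (List; length; filter; map; upTo)
open import Data.Nat
open import Data.Nat.Divisibility using (_∣_; _∣?_; ∣⇒≤; _∣0; 1∣_)
open import Data.Nat.Properties using (anyUpTo?)
open import Data.Product using (∃-syntax; _×_; _,_)
open import Relation.Nullary using (Dec; yes; does; ¬?; map′; _×-dec_)
open import Relation.Unary using (Pred; Decidable)

count : ∀ {ℓ} {P : Pred ℕ ℓ} → Decidable P → List ℕ → ℕ
count P? xs = length (filter P? xs)

-- 2n - 2h + 1 is an integer, not a truncated difference, since h may
-- exceed n when x = 0.
Counted : ℕ → ℕ → Set
Counted n x =
  ∃[ h ] 0 < h × h ∣ x ×
    (+ (2 * x + 1)) ℤ.∣ (+ (2 * n) ℤ.- + (2 * h) ℤ.+ 1ℤ)

-- For x = 0 the witness h = 1 always works; for x > 0 any h dividing x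
-- satisfies h ≤ x, so the search is bounded.
counted? : ∀ n → Decidable (Counted n)
counted? n zero = yes (1 , s≤s z≤n , 1 ∣0 , 1∣ _)
counted? n x@(suc _) =
  map′ (λ (h , _ , p) → h , p)
       (λ (h , 0<h , h∣x , d) → h , s≤s (∣⇒≤ h∣x) , 0<h , h∣x , d)
       (anyUpTo? (λ h → (0 <? h) ×-dec (h ∣? x) ×-dec (_ ∣? _)) (suc x))

a : ℕ → ℕ
a n = count (counted? n) (upTo n)

-- Divisors are searched among 1, …, m, so τ and τₒ are meant for m ≥ 1.
τ : ℕ → ℕ
τ m = count (_∣? m) (map suc (upTo m))

τₒ : ℕ → ℕ
τₒ m = count (λ d → (d ∣? m) ×-dec ¬? (2 ∣? d)) (map suc (upTo m))

infix 4 _≡_[mod_] _≡?_[mod_]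

_≡_[mod_] : ℤ → ℤ → ℕ → Set
i ≡ j [mod m ] = + m ℤ.∣ (i ℤ.- j)

_≡?_[mod_] : ∀ i j m → Dec (i ≡ j [mod m ])
i ≡? j [mod m ] = m ∣? ℤ.∣ i ℤ.- j ∣

δ : ∀ {ℓ} {P : Set ℓ} → Dec P → ℕ
δ P? = if does P? then 1 else 0

{-# OPTIONS --safe #-}

-- The admissible choices h = 1, h = x and h = n ∸ x show that x is counted as
-- soon as 2x + 1 divides 2n − 1, or 2x + 1 divides n + 1, or n ∸ x divides n.
-- These conditions cut out sets of τ(2n − 1), τₒ(n + 1) and τ(n) integers below
-- n.  Two of them hold together only for x = 0, for x = 1 if 3 ∣ n + 1, for
-- x = n − 1, and for x = n / 2 if n is even.  Counting the first overlap
-- separately from that of the third set with the union of the first two gives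
-- 3 + δ(2 ∣ n) + δ(3 ∣ n + 1) as an upper bound for the double counting.

module Submission where

open import Defs
open import Data.Nat using (ℕ; _+_; _*_; _∸_; _≤_; _⊔_)
open import Data.Integer as ℤ using (ℤ; +_; -1ℤ; 0ℤ)
open import Data.Product using (_×_)

open import Data.Nat
  using (zero; suc; _<_; z≤n; s≤s; z<s; _≟_; ⌊_/2⌋; >-nonZero)
open import Data.Nat.Properties
open import Data.Nat.Divisibility
open import Data.Nat.Tactic.RingSolver using (solve-∀)
import Data.Integer.Properties as ℤ
open import Data.List.Base using (List; []; _∷_; [_]; _++_; length; filter; map; upTo)
open import Data.List.Properties using (length-++; length-map; length-filter; filter-none)
open import Data.List.Membership.Propositional using (_∈_)
open import Data.List.Membership.Propositional.Properties
open import Data.List.Relation.Binary.Subset.Propositional using (_⊆_)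
import Data.List.Relation.Unary.All as All
open import Data.List.Relation.Unary.AllPairs using ([]; _∷_)
open import Data.List.Relation.Unary.Any using (here; there)
open import Data.List.Relation.Unary.Unique.Propositional using (Unique)
open import Data.List.Relation.Unary.Unique.Propositional.Properties
  using (upTo⁺; filter⁺; map⁺)
open import Data.Product using (∃-syntax; _,_; proj₂)
open import Data.Sum.Base using (_⊎_; inj₁; inj₂; [_,_]′)
open import Function.Base using (_∘_; id)
open import Relation.Binary.PropositionalEquality
  using (_≡_; refl; sym; trans; cong; subst; module ≡-Reasoning)
open import Relation.Nullary using (¬_; Dec; yes; no; contradiction; _×-dec_)
open import Relation.Unary using (Pred; Decidable; _∪_; _∩_)
open import Relation.Unary.Properties using (_∪?_; _∩?_)

-- Counting the entries of a list without repetitions.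

-- Induction on `xs`: cut one occurrence of the head `x` out of `ys`. The tail of `xs` still lies in
-- what remains, because uniqueness keeps `x` out of it.
unique-⊆⇒length≤ : ∀ {a} {A : Set a} {xs ys : List A} →
  Unique xs → xs ⊆ ys → length xs ≤ length ys
unique-⊆⇒length≤ [] _ = z≤n
unique-⊆⇒length≤ {xs = x ∷ xs} (x∉xs ∷ xs!) xs⊆ys
  with us , vs , refl ← ∈-∃++ (xs⊆ys (here refl)) = begin
    suc (length xs)              ≤⟨ s≤s (unique-⊆⇒length≤ xs! xs⊆us++vs) ⟩
    suc (length (us ++ vs))      ≡⟨ cong suc (length-++ us) ⟩
    suc (length us + length vs)  ≡⟨ +-suc (length us) (length vs) ⟨
    length us + suc (length vs)  ≡⟨ length-++ us ⟨
    length (us ++ x ∷ vs)        ∎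
  where
  open ≤-Reasoning
  xs⊆us++vs : xs ⊆ us ++ vs
  xs⊆us++vs z∈xs with ∈-++⁻ us (xs⊆ys (there z∈xs))
  ... | inj₁ z∈us         = ∈-++⁺ˡ z∈us
  ... | inj₂ (here refl)  = contradiction refl (All.lookup x∉xs z∈xs)
  ... | inj₂ (there z∈vs) = ∈-++⁺ʳ us z∈vs

module _ {p q} {P : Pred ℕ p} {Q : Pred ℕ q} (P? : Decidable P) (Q? : Decidable Q) where

  -- The selected entries of `xs` are distinct and all occur among the `g`-images of the selected
  -- entries of `ys`. Since `g` only has to hit them, injectivity never has to be proved.
  count-image-≤ : ∀ {xs ys} (g : ℕ → ℕ) → Unique xs →
    (∀ {x} → x ∈ xs → P x → ∃[ y ] y ∈ ys × x ≡ g y × Q y) →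
    count P? xs ≤ count Q? ys
  count-image-≤ {xs} {ys} g xs! preimage = begin
    length (filter P? xs)          ≤⟨ unique-⊆⇒length≤ (filter⁺ P? xs!) covered ⟩
    length (map g (filter Q? ys))  ≡⟨ length-map g (filter Q? ys) ⟩
    length (filter Q? ys)          ∎
    where
    open ≤-Reasoning
    covered : filter P? xs ⊆ map g (filter Q? ys)
    covered x∈ with x∈xs , px ← ∈-filter⁻ P? x∈ = ∈-map∘filter⁺ g Q? (preimage x∈xs px)

  count-mono : ∀ {xs} → Unique xs → (∀ {x} → x ∈ xs → P x → Q x) →
    count P? xs ≤ count Q? xs
  count-mono xs! P⇒Q = count-image-≤ id xs! (λ x∈xs px → _ , x∈xs , refl , P⇒Q x∈xs px)

  count-∪-∩ : ∀ xs → count P? xs + count Q? xs ≡ count (P? ∪? Q?) xs + count (P? ∩? Q?) xs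
  count-∪-∩ [] = refl
  count-∪-∩ (x ∷ xs) with ih ← count-∪-∩ xs | P? x | Q? x
  ... | yes _ | yes _ = cong suc (trans (+-suc _ _) (trans (cong suc ih) (sym (+-suc _ _))))
  ... | yes _ | no  _ = cong suc ih
  ... | no  _ | yes _ = trans (+-suc _ _) (cong suc ih)
  ... | no  _ | no  _ = ih

  count-∪-≤ : ∀ xs → count (P? ∪? Q?) xs ≤ count P? xs + count Q? xs
  count-∪-≤ xs = ≤-trans (m≤m+n _ _) (≤-reflexive (sym (count-∪-∩ xs)))

-- If `B` holds, comparison with the one-entry list `[ c ]` bounds the count by 1; if it fails,
-- nothing survives the filter.
count-≡-≤-δ : ∀ {b} {B : Set b} (B? : Dec B) c {xs} → Unique xs →
  count (λ x → (x ≟ c) ×-dec B?) xs ≤ δ B?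
count-≡-≤-δ B?@(yes b) c xs! = ≤-trans
  (count-image-≤ _ (λ x → (x ≟ c) ×-dec B?) id xs!
    (λ _ (x≡c , b) → c , here refl , x≡c , refl , b))
  (length-filter (λ x → (x ≟ c) ×-dec B?) [ c ])
count-≡-≤-δ B?@(no ¬b) c {xs} _ = ≤-reflexive
  (cong length (filter-none (λ x → (x ≟ c) ×-dec B?) {xs} (All.universal (λ _ → ¬b ∘ proj₂) xs)))

count-≡-≤-1 : ∀ c {xs} → Unique xs → count (_≟ c) xs ≤ 1
count-≡-≤-1 c xs! = ≤-trans
  (count-image-≤ (_≟ c) (_≟ c) id xs! (λ _ x≡c → c , here refl , x≡c , refl))
  (length-filter (_≟ c) [ c ])

-- Odd numbers and the search range for divisors.

odd⇒2x+1 : ∀ d → ¬ 2 ∣ d → ∃[ x ] d ≡ 2 * x + 1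
odd⇒2x+1 zero          2∤d = contradiction (2 ∣0) 2∤d
odd⇒2x+1 (suc zero)    _   = 0 , refl
odd⇒2x+1 (suc (suc d)) 2∤d with x , refl ← odd⇒2x+1 d (2∤d ∘ ∣m∣n⇒∣m+n ∣-refl)
  = suc x , eq x
  where
  eq : ∀ x → 2 + (2 * x + 1) ≡ 2 * suc x + 1
  eq = solve-∀

2∤2x+1 : ∀ x → ¬ 2 ∣ 2 * x + 1
2∤2x+1 x 2∣ with () ← ∣1⇒≡1 (∣m+n∣m⇒∣n 2∣ (m∣m*n x))

2[1+m]∸1≡2m+1 : ∀ m → 2 * suc m ∸ 1 ≡ 2 * m + 1
2[1+m]∸1≡2m+1 m = trans (+-suc m (m + 0)) (+-comm 1 (2 * m))

∈-range⁺ : ∀ {d m} → 0 < d → d ≤ m → d ∈ map suc (upTo m)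
∈-range⁺ {suc d} _ d<m = ∈-map⁺ suc (∈-upTo⁺ d<m)

∈-range⁻ : ∀ {d m} → d ∈ map suc (upTo m) → 0 < d × d ≤ m
∈-range⁻ d∈ with _ , x∈ , refl ← ∈-map⁻ suc d∈ = z<s , ∈-upTo⁻ x∈

range-unique : ∀ m → Unique (map suc (upTo m))
range-unique m = map⁺ suc-injective (upTo⁺ m)

-- Three sufficient conditions for being counted.

-- Writing n as `h + k` turns 2n - 2h + 1 into 2k + 1, so the integer subtraction is dealt with once
-- for all three choices of `h`.
counted : ∀ {h x} k → 0 < h → h ∣ x → 2 * x + 1 ∣ 2 * k + 1 → Counted (h + k) x
counted {h} {x} k 0<h h∣x d = h , 0<h , h∣x , subst (λ z → 2 * x + 1 ∣ ℤ.∣ z ∣) (sym eq) d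
  where
  open ≡-Reasoning
  eq : + (2 * (h + k)) ℤ.- + (2 * h) ℤ.+ + 1 ≡ + (2 * k + 1)
  eq = cong (ℤ._+ + 1) (begin
    + (2 * (h + k)) ℤ.- + (2 * h)  ≡⟨ ℤ.m-n≡m⊖n (2 * (h + k)) (2 * h) ⟩
    2 * (h + k) ℤ.⊖ 2 * h          ≡⟨ ℤ.⊖-≥ (*-monoʳ-≤ 2 (m≤m+n h k)) ⟩
    + (2 * (h + k) ∸ 2 * h)        ≡⟨ cong +_ (*-distribˡ-∸ 2 (h + k) h) ⟨
    + (2 * (h + k ∸ h))            ≡⟨ cong (λ z → + (2 * z)) (m+n∸m≡n h k) ⟩
    + (2 * k)                      ∎)

-- Each predicate is named after its choice of h: 1, x and n ∸ x.
ByOne BySelf ByComplement : ℕ → Pred ℕ _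
ByOne        n x = 2 * x + 1 ∣ 2 * n ∸ 1
BySelf       n x = 2 * x + 1 ∣ n + 1
ByComplement n x = n ∸ x ∣ n

byOne? : ∀ n → Decidable (ByOne n)
byOne? n x = 2 * x + 1 ∣? 2 * n ∸ 1

bySelf? : ∀ n → Decidable (BySelf n)
bySelf? n x = 2 * x + 1 ∣? n + 1

byComplement? : ∀ n → Decidable (ByComplement n)
byComplement? n x = n ∸ x ∣? n

byOne⇒counted : ∀ {n x} → x < n → ByOne n x → Counted n x
byOne⇒counted {suc m} {x} _ d =
  counted m z<s (1∣ x) (subst (2 * x + 1 ∣_) (2[1+m]∸1≡2m+1 m) d)

bySelf⇒counted : ∀ {n x} → x < n → BySelf n x → Counted n x
-- The choice h = x is not positive here; h = 1 serves, since 2x + 1 = 1 divides everything.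
bySelf⇒counted {n} {zero} _ _ = 1 , z<s , 1 ∣0 , 1∣ _
-- With n = x + k, doubling n + 1 gives (2x + 1) + (2k + 1), so 2x + 1 divides 2k + 1.
bySelf⇒counted {n} {x@(suc _)} x<n d with k , refl ← m≤n⇒∃[o]m+o≡n (<⇒≤ x<n) =
  counted k z<s ∣-refl
    (∣m+n∣m⇒∣n (subst (2 * x + 1 ∣_) (eq x k) (∣n⇒∣m*n 2 d)) ∣-refl)
  where
  eq : ∀ x k → 2 * (x + k + 1) ≡ (2 * x + 1) + (2 * k + 1)
  eq = solve-∀

-- Turns the truncated difference n ∸ x into a positive summand h of n = h + x.
byComplement⁻ : ∀ {n x} → x < n → ByComplement n x →
  ∃[ h ] 0 < h × h ∣ x × h + x ≡ n
byComplement⁻ {n} {x} x<n d =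
  n ∸ x , m<n⇒0<n∸m x<n , ∣m+n∣m⇒∣n (subst (n ∸ x ∣_) (sym eq) d) ∣-refl , eq
  where
  eq : n ∸ x + x ≡ n
  eq = m∸n+n≡m (<⇒≤ x<n)

byComplement⇒counted : ∀ {n x} → x < n → ByComplement n x → Counted n x
byComplement⇒counted {x = x} x<n d with _ , 0<h , h∣x , refl ← byComplement⁻ x<n d =
  -- Here k = x, so the required divisibility is that of 2x + 1 by itself.
  counted x 0<h h∣x ∣-refl

-- Divisors as elements of the three sets.

-- A divisor d corresponds to x = n ∸ d: positivity of d puts x below n, and d ≤ n makes the
-- truncated difference reversible.
τ≤byComplement : ∀ {n} → 0 < n → τ n ≤ count (byComplement? n) (upTo n)
τ≤byComplement {n} 0<n =
  count-image-≤ (_∣? n) (byComplement? n) (n ∸_) (range-unique n) preimage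
  where
  preimage : ∀ {d} → d ∈ map suc (upTo n) → d ∣ n →
    ∃[ x ] x ∈ upTo n × d ≡ n ∸ x × ByComplement n x
  preimage {d} d∈ d∣n with 0<d , d≤n ← ∈-range⁻ d∈ =
    n ∸ d , ∈-upTo⁺ (∸-monoʳ-< 0<d d≤n) , sym eq , subst (_∣ n) (sym eq) d∣n
    where
    eq : n ∸ (n ∸ d) ≡ d
    eq = m∸[m∸n]≡n d≤n

-- As 2n - 1 is odd, each of its divisors has the form 2x + 1, and 2x + 1 ≤ 2n - 1 means x < n.
τ≤byOne : ∀ {n} → 0 < n → τ (2 * n ∸ 1) ≤ count (byOne? n) (upTo n)
τ≤byOne {suc m} _ = count-image-≤ (_∣? 2 * suc m ∸ 1) (byOne? (suc m)) (λ x → 2 * x + 1)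
  (range-unique (2 * suc m ∸ 1)) preimage
  where
  preimage : ∀ {d} → d ∈ map suc (upTo (2 * suc m ∸ 1)) → d ∣ 2 * suc m ∸ 1 →
    ∃[ x ] x ∈ upTo (suc m) × d ≡ 2 * x + 1 × ByOne (suc m) x
  preimage {d} d∈ d∣
    with x , refl ← odd⇒2x+1 d
      (λ 2∣d → 2∤2x+1 m (subst (2 ∣_) (2[1+m]∸1≡2m+1 m) (∣-trans 2∣d d∣))) =
    x , ∈-upTo⁺ (s≤s (*-cancelˡ-≤ 2 (+-cancelʳ-≤ 1 (2 * x) (2 * m)
      (subst (2 * x + 1 ≤_) (2[1+m]∸1≡2m+1 m) (proj₂ (∈-range⁻ d∈)))))) , refl , d∣

τₒ≤bySelf : ∀ {n} → 0 < n → τₒ (n + 1) ≤ count (bySelf? n) (upTo n)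
τₒ≤bySelf {n} 0<n = count-image-≤ _ (bySelf? n) (λ x → 2 * x + 1)
  (range-unique (n + 1)) preimage
  where
  -- The hypothesis gives only 2x ≤ n, which yields x < n through x < 2x when x is positive; for x =
  -- 0 the assumption 0 < n is used.
  small : ∀ x → 2 * x + 1 ≤ n + 1 → x < n
  small zero      _  = 0<n
  small x@(suc _) le =
    <-≤-trans (m<m*n x 2 (s≤s (s≤s z≤n)))
      (subst (_≤ n) (*-comm 2 x) (+-cancelʳ-≤ 1 (2 * x) n le))
  preimage : ∀ {d} → d ∈ map suc (upTo (n + 1)) → (d ∣ n + 1) × ¬ 2 ∣ d →
    ∃[ x ] x ∈ upTo n × d ≡ 2 * x + 1 × BySelf n x
  preimage {d} d∈ (d∣ , 2∤d) with x , refl ← odd⇒2x+1 d 2∤d =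
    x , ∈-upTo⁺ (small x (proj₂ (∈-range⁻ d∈))) , refl , d∣

-- Pairwise overlaps of the three sets.

-- 2 (n + 1) = (2n − 1) + 3
byOne∩bySelf : ∀ {n x} → x < n → ByOne n x → BySelf n x →
  x ≡ 0 ⊎ (x ≡ 1 × (+ n ≡ -1ℤ [mod 3 ]))
byOne∩bySelf {suc m} {x} _ d₁ d₂ = go x 2x+1∣3 d₂
  where
  eq : ∀ m → 2 * (suc m + 1) ≡ (2 * m + 1) + 3
  eq = solve-∀
  2x+1∣3 : 2 * x + 1 ∣ 3
  2x+1∣3 = ∣m+n∣m⇒∣n (subst (2 * x + 1 ∣_) (eq m) (∣n⇒∣m*n 2 d₂))
    (subst (2 * x + 1 ∣_) (2[1+m]∸1≡2m+1 m) d₁)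
  -- The congruence modulo 3 computes to 3 ∣ n + 1, because n - (-1) reduces to n + 1.
  go : ∀ x → 2 * x + 1 ∣ 3 → 2 * x + 1 ∣ suc m + 1 →
    x ≡ 0 ⊎ (x ≡ 1 × 3 ∣ suc m + 1)
  go zero          _   _ = inj₁ refl
  go (suc zero)    _   d = inj₂ (refl , d)
  go (suc (suc y)) 2x+1∣3 _ =
    contradiction (+-cancelʳ-≤ 1 (2 * (2 + y)) 2 (∣⇒≤ 2x+1∣3))
      (<⇒≱ (*-monoʳ-< 2 (s≤s (z<s {y}))))

-- With n = h + x and h ≤ x, 2x + 1 divides 2n − 1 = (2x + 1) + 2 (h − 1),
-- and 2 (h − 1) < 2x + 1 forces h = 1.
byOne∩byComplement : ∀ {n x} → x < n → ByOne n x → ByComplement n x →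
  x ≡ 0 ⊎ x ≡ n ∸ 1
byOne∩byComplement {x = zero} _ _ _ = inj₁ refl
byOne∩byComplement {x = x@(suc _)} x<n d₁ d₃ with byComplement⁻ x<n d₃
... | suc zero , _ , _ , refl = inj₂ refl
-- From here `h` is the divisor minus 1 and is positive, so 2x + 1 would be at most 2h, whereas
-- `suc h` ≤ x.
... | suc h@(suc _) , _ , h∣x , refl =
  contradiction (∣⇒≤ (∣m+n∣m⇒∣n (subst (2 * x + 1 ∣_) (eq h x) d₁′) ∣-refl))
    (<⇒≱ (≤-<-trans (*-monoʳ-≤ 2 (<⇒≤ (∣⇒≤ h∣x))) (m<m+n (2 * x) z<s)))
  where
  d₁′ : 2 * x + 1 ∣ 2 * (h + x) + 1
  d₁′ = subst (2 * x + 1 ∣_) (2[1+m]∸1≡2m+1 (h + x)) d₁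
  eq : ∀ h x → 2 * (h + x) + 1 ≡ (2 * x + 1) + 2 * h
  eq = solve-∀

-- With n = h + x and h ≤ x, 2x + 1 ≤ n + 1 = h + x + 1 forces h = x.
bySelf∩byComplement : ∀ {n x} → x < n → BySelf n x → ByComplement n x →
  x ≡ 0 ⊎ (x ≡ ⌊ n /2⌋ × (+ n ≡ 0ℤ [mod 2 ]))
bySelf∩byComplement {x = zero} _ _ _ = inj₁ refl
bySelf∩byComplement {x = x@(suc _)} x<n d₂ d₃
  with h , 0<h , h∣x , refl ← byComplement⁻ x<n d₃
  -- Both claims are proved with x in place of `h` and then transported along x = `h`. The summand 0
  -- comes from computing n - 0 in the integers.
  = inj₂ (subst (λ k → x ≡ ⌊ k + x /2⌋ × 2 ∣ k + x + 0) (≤-antisym x≤h (∣⇒≤ h∣x))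
      (n≡⌊n+n/2⌋ x , subst (2 ∣_) (eq x) (m∣m*n x)))
  where
  x≤h : x ≤ h
  x≤h = +-cancelʳ-≤ x x h (subst (_≤ h + x) (cong (λ z → x + z) (+-identityʳ x))
    (+-cancelʳ-≤ 1 (2 * x) (h + x)
      (∣⇒≤ {{>-nonZero (<-≤-trans z<s (m≤n+m 1 (h + x)))}} d₂)))
  eq : ∀ x → 2 * x ≡ x + x + 0
  eq = solve-∀

-- Inclusion-exclusion and the final bounds.

m≤n+k⇒m-k≤n : ∀ {i j} k → i ℤ.≤ j ℤ.+ + k → i ℤ.- + k ℤ.≤ j
m≤n+k⇒m-k≤n {i} {j} k i≤j+k = begin
  i ℤ.- + k                ≤⟨ ℤ.+-monoˡ-≤ (ℤ.- + k) i≤j+k ⟩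
  (j ℤ.+ + k) ℤ.- + k      ≡⟨ ℤ.+-assoc j (+ k) (ℤ.- + k) ⟩
  j ℤ.+ (+ k ℤ.- + k)      ≡⟨ cong (ℤ._+_ j) (ℤ.+-inverseʳ (+ k)) ⟩
  j ℤ.+ 0ℤ                 ≡⟨ ℤ.+-identityʳ j ⟩
  j                        ∎
  where open ℤ.≤-Reasoning

module _ {n : ℕ} (0<n : 1 ≤ n) where

  private
    I = upTo n
    I! = upTo⁺ n
    P? = byOne? n
    Q? = bySelf? n
    R? = byComplement? n
    even? = + n ≡? 0ℤ [mod 2 ]
    2mod3? = + n ≡? -1ℤ [mod 3 ]
    1∧2mod3? = λ x → (x ≟ 1) ×-dec 2mod3?
    half∧even? = λ x → (x ≟ ⌊ n /2⌋) ×-dec even?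

  count-byOne∩bySelf : count (P? ∩? Q?) I ≤ 1 + δ 2mod3?
  count-byOne∩bySelf = begin
    count (P? ∩? Q?) I
      ≤⟨ count-mono (P? ∩? Q?) ((_≟ 0) ∪? 1∧2mod3?) I!
           (λ x∈ (p , q) → byOne∩bySelf (∈-upTo⁻ x∈) p q) ⟩
    count ((_≟ 0) ∪? 1∧2mod3?) I
      ≤⟨ count-∪-≤ (_≟ 0) 1∧2mod3? I ⟩
    count (_≟ 0) I + count 1∧2mod3? I
      ≤⟨ +-mono-≤ (count-≡-≤-1 0 I!) (count-≡-≤-δ 2mod3? 1 I!) ⟩
    1 + δ 2mod3?
      ∎
    where open ≤-Reasoning

  -- The 2 accounts for x = 0 and x = n - 1. The point 0 lies in all three sets, so it is rightly
  -- charged here as well as in `count-byOne∩bySelf`.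
  count-[byOne∪bySelf]∩byComplement : count ((P? ∪? Q?) ∩? R?) I ≤ 2 + δ even?
  count-[byOne∪bySelf]∩byComplement = begin
    count ((P? ∪? Q?) ∩? R?) I
      ≤⟨ count-mono ((P? ∪? Q?) ∩? R?) E? I! doubly⇒E ⟩
    count E? I
      ≤⟨ count-∪-≤ (_≟ 0) ((_≟ n ∸ 1) ∪? half∧even?) I ⟩
    count (_≟ 0) I + count ((_≟ n ∸ 1) ∪? half∧even?) I
      ≤⟨ +-monoʳ-≤ _ (count-∪-≤ (_≟ n ∸ 1) half∧even? I) ⟩
    count (_≟ 0) I + (count (_≟ n ∸ 1) I + count half∧even? I)
      ≤⟨ +-mono-≤ (count-≡-≤-1 0 I!)
           (+-mono-≤ (count-≡-≤-1 (n ∸ 1) I!) (count-≡-≤-δ even? ⌊ n /2⌋ I!)) ⟩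
    2 + δ even?
      ∎
    where
    open ≤-Reasoning
    E? = (_≟ 0) ∪? ((_≟ n ∸ 1) ∪? half∧even?)
    doubly⇒E : ∀ {x} → x ∈ I → ((ByOne n ∪ BySelf n) ∩ ByComplement n) x →
      x ≡ 0 ⊎ x ≡ n ∸ 1 ⊎ (x ≡ ⌊ n /2⌋ × (+ n ≡ 0ℤ [mod 2 ]))
    doubly⇒E x∈ (inj₁ p , r) = [ inj₁ , inj₂ ∘ inj₁ ]′ (byOne∩byComplement (∈-upTo⁻ x∈) p r)
    doubly⇒E x∈ (inj₂ q , r) = [ inj₁ , inj₂ ∘ inj₂ ]′ (bySelf∩byComplement (∈-upTo⁻ x∈) q r)

  count-∪-≤-a : count ((P? ∪? Q?) ∪? R?) I ≤ a n
  count-∪-≤-a = count-mono ((P? ∪? Q?) ∪? R?) (counted? n) I!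
    (λ x∈ → let x<n = ∈-upTo⁻ x∈ in
      [ [ byOne⇒counted x<n , bySelf⇒counted x<n ]′ , byComplement⇒counted x<n ]′)

  -- Inclusion-exclusion is applied twice, with the corrections kept as summands on the right so
  -- that no truncated subtraction arises.
  τ-sum-≤ : τ n + τ (2 * n ∸ 1) + τₒ (n + 1) ≤ a n + δ 2mod3? + δ even? + 3
  τ-sum-≤ = begin
    τ n + τ (2 * n ∸ 1) + τₒ (n + 1)
      ≤⟨ +-mono-≤ (+-mono-≤ (τ≤byComplement 0<n) (τ≤byOne 0<n)) (τₒ≤bySelf 0<n) ⟩
    count R? I + count P? I + count Q? I
      ≡⟨ rotate (count R? I) (count P? I) (count Q? I) ⟩
    (count P? I + count Q? I) + count R? I
      ≡⟨ cong (_+ count R? I) (count-∪-∩ P? Q? I) ⟩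
    (count (P? ∪? Q?) I + count (P? ∩? Q?) I) + count R? I
      ≡⟨ swap (count (P? ∪? Q?) I) (count (P? ∩? Q?) I) (count R? I) ⟩
    (count (P? ∪? Q?) I + count R? I) + count (P? ∩? Q?) I
      ≡⟨ cong (_+ count (P? ∩? Q?) I) (count-∪-∩ (P? ∪? Q?) R? I) ⟩
    (count ((P? ∪? Q?) ∪? R?) I + count ((P? ∪? Q?) ∩? R?) I) + count (P? ∩? Q?) I
      ≤⟨ +-mono-≤ (+-mono-≤ count-∪-≤-a count-[byOne∪bySelf]∩byComplement) count-byOne∩bySelf ⟩
    (a n + (2 + δ even?)) + (1 + δ 2mod3?)
      ≡⟨ collect (a n) (δ even?) (δ 2mod3?) ⟩
    a n + δ 2mod3? + δ even? + 3
      ∎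
    where
    open ≤-Reasoning
    rotate : ∀ r p q → r + p + q ≡ p + q + r
    rotate = solve-∀
    swap : ∀ u v r → u + v + r ≡ u + r + v
    swap = solve-∀
    collect : ∀ c e t → (c + (2 + e)) + (1 + t) ≡ c + t + e + 3
    collect = solve-∀

theorem10 : ∀ (n : ℕ) → 1 ≤ n →
    (τ n ⊔ τ (2 * n ∸ 1) ⊔ τₒ (n + 1) ≤ a n) ×
    (+ τ n ℤ.+ + τ (2 * n ∸ 1) ℤ.+ + τₒ (n + 1) ℤ.- + 3
    ℤ.- + δ (+ n ≡? 0ℤ [mod 2 ]) ℤ.- + δ (+ n ≡? -1ℤ [mod 3 ]) ℤ.≤ + a n)
theorem10 n 0<n =
    ⊔-lub (⊔-lub
      (≤-trans (τ≤byComplement 0<n) (into-a (byComplement? n) byComplement⇒counted))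
      (≤-trans (τ≤byOne 0<n) (into-a (byOne? n) byOne⇒counted)))
      (≤-trans (τₒ≤bySelf 0<n) (into-a (bySelf? n) bySelf⇒counted))
  -- The subtracted terms move across from the outermost inwards, which fixes the order of the
  -- summands in `τ-sum-≤`.
  , m≤n+k⇒m-k≤n (δ (+ n ≡? -1ℤ [mod 3 ]))
      (m≤n+k⇒m-k≤n (δ (+ n ≡? 0ℤ [mod 2 ]))
        (m≤n+k⇒m-k≤n 3 (ℤ.+≤+ (τ-sum-≤ 0<n))))
  where
  into-a : ∀ {p} {P : Pred ℕ p} (P? : Decidable P) →
    (∀ {x} → x < n → P x → Counted n x) → count P? (upTo n) ≤ a n
  into-a P? P⇒counted = count-mono P? (counted? n) (upTo⁺ n) (P⇒counted ∘ ∈-upTo⁻)
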